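{- For all binary relations $R$ and $S$ on IMP states and all IMP commands $c$ and $c'$, $\vDash \langle R\rangle\ c,\ c'\ \langle S\rangle$ holds if and only if both of the following hold: (i) for every state $t'$, $\langle \lambda t.\,R(t,t')\rangle\ c\ \langle \lambda t.\,\mathsf{decomp}(R,c,c',S)(t,t')\rangle$; (ii) for every state $t$, $\langle \lambda s'.\,\mathsf{decomp}(R,c,c',S)(t,s')\rangle\ c'\ \langle \lambda t'.\,S(t,t')\rangle$.
   Context: IMP commands: $c ::= x := e \mid c;c \mid \mathbf{if}\ b\ \mathbf{then}\ c\ \mathbf{else}\ c \mid \mathbf{while}\ b\ \mathbf{do}\ c \mid \mathbf{skip}$ over integer arithmetic expressions $e$ and boolean expressions $b$. States map variables to integers; $(c,s)\Rightarrow t$ is the standard big-step semantics of IMP. Relations are binary relations on states. Under-approximate relational validity: $\vDash \langle R\rangle\ c,\ c'\ \langle S\rangle$ iff $\forall t\,t'.\ S(t,t') \implies \exists s\,s'.\ R(s,s')\land (c,s)\Rightarrow t\land (c',s')\Rightarrow t'$. Under-approximate Hoare validity for predicates $P,Q$ on states: $\langle P\rangle\ c\ \langle Q\rangle$ iff $\forall t.\ Q(t)\implies\exists s.\ P(s)\land (c,s)\Rightarrow t$. The relation $\mathsf{decomp}(R,c,c',S)$ is defined by $\mathsf{decomp}(R,c,c',S)(t,s') \equiv \exists s\,t'.\ R(s,s')\land (c,s)\Rightarrow t\land (c',s')\Rightarrow t'\land S(t,t')$. -}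

module Defs where

open import Data.Nat using (ℕ)
open import Data.Nat.Properties using () renaming (_≟_ to _≟ℕ_)
open import Data.Integer using (ℤ; _+_; _-_; _*_; _≤ᵇ_; 1ℤ)
open import Data.Bool using (Bool; true; false; not; _∧_; if_then_else_)
open import Data.Product using (Σ; ∃; ∃-syntax; _×_; _,_)
open import Relation.Nullary.Decidable using (⌊_⌋)
open import Relation.Binary.PropositionalEquality using (_≡_)

Var : Set
Var = ℕ

State : Set
State = Var → ℤ

data AExp : Set where
  N    : ℤ → AExp
  V    : Var → AExp
  Plus : AExp → AExp → AExp
  Minus : AExp → AExp → AExp
  Times : AExp → AExp → AExp

aval : AExp → State → ℤ
aval (N n) s = n
aval (V x) s = s x
aval (Plus a b) s = aval a s + aval b s
aval (Minus a b) s = aval a s - aval b s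
aval (Times a b) s = aval a s * aval b s

data BExp : Set where
  Bc   : Bool → BExp
  Not  : BExp → BExp
  And  : BExp → BExp → BExp
  Less : AExp → AExp → BExp

bval : BExp → State → Bool
bval (Bc v) s = v
bval (Not b) s = not (bval b s)
bval (And b₁ b₂) s = bval b₁ s ∧ bval b₂ s
bval (Less a₁ a₂) s = (aval a₁ s + 1ℤ) ≤ᵇ aval a₂ s

data Com : Set where
  SKIP   : Com
  _::=_  : Var → AExp → Com
  _⨾_   : Com → Com → Com
  IF_THEN_ELSE_ : BExp → Com → Com → Com
  WHILE_DO_ : BExp → Com → Com

_[_↦_] : State → Var → ℤ → State
(s [ x ↦ v ]) y = if ⌊ y ≟ℕ x ⌋ then v else s y

data _⊢_⇒_ : Com → State → State → Set where
  Skip    : ∀ {s} → SKIP ⊢ s ⇒ s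
  Assign  : ∀ {x a s} → (x ::= a) ⊢ s ⇒ (s [ x ↦ aval a s ])
  Seq     : ∀ {c₁ c₂ s₁ s₂ s₃} → c₁ ⊢ s₁ ⇒ s₂ → c₂ ⊢ s₂ ⇒ s₃ → (c₁ ⨾ c₂) ⊢ s₁ ⇒ s₃
  IfTrue  : ∀ {b c₁ c₂ s t} → bval b s ≡ true → c₁ ⊢ s ⇒ t → (IF b THEN c₁ ELSE c₂) ⊢ s ⇒ t
  IfFalse : ∀ {b c₁ c₂ s t} → bval b s ≡ false → c₂ ⊢ s ⇒ t → (IF b THEN c₁ ELSE c₂) ⊢ s ⇒ t
  WhileFalse : ∀ {b c s} → bval b s ≡ false → (WHILE b DO c) ⊢ s ⇒ s
  WhileTrue  : ∀ {b c s₁ s₂ s₃} → bval b s₁ ≡ true → c ⊢ s₁ ⇒ s₂ →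
               (WHILE b DO c) ⊢ s₂ ⇒ s₃ → (WHILE b DO c) ⊢ s₁ ⇒ s₃

-- (c , s) ⇒ t written as  c ⊢ s ⇒ t  above.

Rel : Set₁
Rel = State → State → Set

Pred : Set₁
Pred = State → Set

⊨⟨_⟩_,_⟨_⟩ : Rel → Com → Com → Rel → Set
⊨⟨ R ⟩ c , c' ⟨ S ⟩ =
  ∀ t t' → S t t' → ∃[ s ] ∃[ s' ] (R s s' × c ⊢ s ⇒ t × c' ⊢ s' ⇒ t')

⟨_⟩_⟨_⟩ : Pred → Com → Pred → Set
⟨ P ⟩ c ⟨ Q ⟩ = ∀ t → Q t → ∃[ s ] (P s × c ⊢ s ⇒ t)

decomp : Rel → Com → Com → Rel → Rel
decomp R c c' S t s' = ∃[ s ] ∃[ t' ] (R s s' × c ⊢ s ⇒ t × c' ⊢ s' ⇒ t' × S t t')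

module Submission where

open import Defs
open import Data.Product using (_×_; _,_)
open import Function.Bundles using (_⇔_; mk⇔)

-- Condition (i) holds unconditionally (a decomposition witness already records
-- an R-related start and a run of c), so the equivalence rests on (ii) alone.
decomp-fst-valid : (R S : Rel) (c c' : Com) (t' : State) →
  ⟨ (λ t → R t t') ⟩ c ⟨ (λ t → decomp R c c' S t t') ⟩
decomp-fst-valid R S c c' t' t (s , _ , Rss' , c⇒t , _ , _) = s , Rss' , c⇒t

valid⇒decomp-snd-valid : (R S : Rel) (c c' : Com) → ⊨⟨ R ⟩ c , c' ⟨ S ⟩ →
  (t : State) → ⟨ (λ s' → decomp R c c' S t s') ⟩ c' ⟨ (λ t' → S t t') ⟩
valid⇒decomp-snd-valid R S c c' valid t t' Stt'
  with valid t t' Stt'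
... | s , s' , Rss' , c⇒t , c'⇒t' = s' , (s , t' , Rss' , c⇒t , c'⇒t' , Stt') , c'⇒t'

decomp-snd-valid⇒valid : (R S : Rel) (c c' : Com) →
  ((t : State) → ⟨ (λ s' → decomp R c c' S t s') ⟩ c' ⟨ (λ t' → S t t') ⟩) →
  ⊨⟨ R ⟩ c , c' ⟨ S ⟩
decomp-snd-valid⇒valid R S c c' snd t t' Stt'
  with snd t t' Stt'
... | s' , (s , _ , Rss' , c⇒t , _ , _) , c'⇒t' = s , s' , Rss' , c⇒t , c'⇒t'

theorem3 : (R S : Rel) (c c' : Com) →
    ⊨⟨ R ⟩ c , c' ⟨ S ⟩ ⇔
      (((t' : State) → ⟨ (λ t → R t t') ⟩ c ⟨ (λ t → decomp R c c' S t t') ⟩)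
       × ((t : State) → ⟨ (λ s' → decomp R c c' S t s') ⟩ c' ⟨ (λ t' → S t t') ⟩))
theorem3 R S c c' = mk⇔
  (λ valid → decomp-fst-valid R S c c' , valid⇒decomp-snd-valid R S c c' valid)
  (λ (_ , snd) → decomp-snd-valid⇒valid R S c c' snd)
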